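{- Let $\Gamma$ be a graph with $P_4\leq\Gamma$ and let $v$ be such that a $(K_v,\Gamma)$-design exists. Then $$\{n\geq v+2 \mid n\equiv 0,1\pmod 3\}\subseteq \mathcal{L}_2\Gamma(v)\subseteq \mathcal{L}_1\Gamma(v).$$
   Context: Graphs are finite and simple; $\Gamma'\leq\Gamma$ means that $\Gamma'$ is (isomorphic to) a subgraph of $\Gamma$. $K_n$ is the complete graph on $n$ vertices and $P_4$ is the path with $4$ vertices and $3$ edges. For graphs $\Gamma\leq K$, a $(K,\Gamma)$-design is a set of subgraphs of $K$, called blocks, each isomorphic to $\Gamma$, whose edge sets partition $E(K)$. A $(K_v,\Gamma)$-design is also called a $\Gamma$-design of order $v$. Given a $(K,\Gamma)$-design $\mathcal B$ and a $(K',\Gamma')$-design $\mathcal B'$ with $\Gamma'\leq\Gamma$, a down-link from $\mathcal B$ to $\mathcal B'$ is a function $f:\mathcal B\to\mathcal B'$ such that, for every $B\in\mathcal B$, $f(B)$ is a subgraph of $B$ (as an actual graph on the given vertices, not merely up to isomorphism). The complete graphs $K=K_v$ and $K'=K_n$ may have different vertex sets. When such an $f$ exists, $\mathcal B$ is said to be down-linked to $\mathcal B'$. Throughout, the target graph is $\Gamma'=P_4$. $\mathcal{L}_1\Gamma(v)$ is the set of all integers $n$ such that there exists some $\Gamma$-design of order $v$ that can be down-linked to some $P_4$-design of order $n$. $\mathcal{L}_2\Gamma(v)$ is the set of all integers $n$ such that every $\Gamma$-design of order $v$ can be down-linked to some $P_4$-design of order $n$. -}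

module Defs where

open import Data.Fin.Base using (Fin)
open import Data.List.Base using (List; length; upTo)
open import Data.List.Membership.Propositional using (_∈_)
open import Data.List.Membership.Propositional.Properties using (∈-upTo⁺)
open import Data.List.Relation.Unary.Unique.Propositional using (Unique)
open import Data.List.Relation.Unary.Unique.Propositional.Properties using (upTo⁺)
open import Data.Nat.Base using (ℕ; suc; _<_)
open import Data.Nat.Properties using (_≟_; _<?_; 1+n≢n)
open import Data.List.Membership.DecPropositional _≟_ using (_∈?_)
open import Data.Product.Base using (Σ-syntax; ∃-syntax; _×_; _,_; proj₁)
open import Data.Product using (∃!)
open import Data.Sum.Base using (_⊎_; [_,_]; swap)
open import Function.Base using (_∘_)
open import Function.Bundles using (_⇔_)
open import Level using (0ℓ) renaming (suc to lsuc)
open import Relation.Binary.Core using (Rel)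
open import Relation.Binary.Definitions using (Decidable; Symmetric; Irreflexive)
open import Relation.Binary.PropositionalEquality using (_≡_; _≢_; refl; ≢-sym)
open import Relation.Nullary.Decidable using (_×-dec_; _⊎-dec_; ¬?)
open import Relation.Unary using (Pred)

-- Finite simple graphs whose vertices are drawn from the common infinite
-- label set ℕ, so that graphs with different vertex sets can be compared as
-- actual graphs and not merely up to isomorphism.
record Graph : Set₁ where
  field
    vertices : List ℕ
    unique   : Unique vertices
    Adj      : Rel ℕ 0ℓ
    Adj?     : Decidable Adj
    sym      : Symmetric Adj
    irrefl   : Irreflexive _≡_ Adj
    support  : ∀ {x y} → Adj x y → x ∈ vertices

open Graph public using (vertices; Adj)

infix 4 _⊑_ _≅_ _≤ᴳ_

record _⊑_ (H G : Graph) : Set where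
  field
    vertices⊆ : ∀ {x} → x ∈ vertices H → x ∈ vertices G
    Adj⊆      : ∀ {x y} → Adj H x y → Adj G x y

-- The values of `to` outside the vertices of G are irrelevant.
record _≅_ (G H : Graph) : Set where
  field
    to         : ℕ → ℕ
    to-∈       : ∀ {x} → x ∈ vertices G → to x ∈ vertices H
    injective  : ∀ {x y} → x ∈ vertices G → y ∈ vertices G → to x ≡ to y → x ≡ y
    surjective : ∀ {z} → z ∈ vertices H → ∃[ x ] x ∈ vertices G × to x ≡ z
    Adj⇔       : ∀ {x y} → x ∈ vertices G → y ∈ vertices G →
                 Adj G x y ⇔ Adj H (to x) (to y)

_≤ᴳ_ : Graph → Graph → Set₁
G ≤ᴳ K = Σ[ H ∈ Graph ] H ⊑ K × G ≅ H

complete : (V : List ℕ) → Unique V → Graph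
complete V u = record
  { vertices = V
  ; unique   = u
  ; Adj      = λ x y → x ∈ V × y ∈ V × x ≢ y
  ; Adj?     = λ x y → x ∈? V ×-dec y ∈? V ×-dec ¬? (x ≟ y)
  ; sym      = λ (x∈V , y∈V , x≢y) → y∈V , x∈V , ≢-sym x≢y
  ; irrefl   = λ x≡y (_ , _ , x≢y) → x≢y x≡y
  ; support  = proj₁
  }

path : ℕ → Graph
path n = record
  { vertices = upTo n
  ; unique   = upTo⁺ n
  ; Adj      = λ x y → x < n × y < n × (suc x ≡ y ⊎ suc y ≡ x)
  ; Adj?     = λ x y → x <? n ×-dec y <? n ×-dec (suc x ≟ y ⊎-dec suc y ≟ x)
  ; sym      = λ (x<n , y<n , s) → y<n , x<n , swap s
  ; irrefl   = λ { refl (_ , _ , s) → [ 1+n≢n , 1+n≢n ] s }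
  ; support  = ∈-upTo⁺ ∘ proj₁
  }

P₄ : Graph
P₄ = path 4

-- The edge sets of the blocks partition the edge set of K: `nonempty` and
-- `partition` together make the blocks pairwise distinct, so that the indexed
-- family `block` amounts to a set of subgraphs.
record Design (K Γ : Graph) : Set₁ where
  field
    Γ≤K       : Γ ≤ᴳ K
    size      : ℕ
    block     : Fin size → Graph
    block⊑K   : ∀ i → block i ⊑ K
    block≅Γ   : ∀ i → block i ≅ Γ
    nonempty  : ∀ i → ∃[ x ] ∃[ y ] Adj (block i) x y
    partition : ∀ {x y} → Adj K x y → ∃! _≡_ (λ i → Adj (block i) x y)

-- The v-element vertex set of K_v is arbitrary.
record DesignOfOrder (Γ : Graph) (v : ℕ) : Set₁ where
  field
    points  : List ℕ
    unique  : Unique points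
    order≡v : length points ≡ v
    design  : Design (complete points unique) Γ
  open Design design public

record DownLink {K Γ K′ Γ′ : Graph} (ℬ : Design K Γ) (ℬ′ : Design K′ Γ′) : Set where
  open Design
  field
    f        : Fin (size ℬ) → Fin (size ℬ′)
    subgraph : ∀ i → block ℬ′ (f i) ⊑ block ℬ i

DownLinkedToOrder : {Γ : Graph} {v : ℕ} → DesignOfOrder Γ v → Pred ℕ (lsuc 0ℓ)
DownLinkedToOrder ℬ n =
  Σ[ ℬ′ ∈ DesignOfOrder P₄ n ] DownLink (DesignOfOrder.design ℬ) (DesignOfOrder.design ℬ′)

ℒ₁ : Graph → ℕ → Pred ℕ (lsuc 0ℓ)
ℒ₁ Γ v n = Σ[ ℬ ∈ DesignOfOrder Γ v ] DownLinkedToOrder ℬ n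

ℒ₂ : Graph → ℕ → Pred ℕ (lsuc 0ℓ)
ℒ₂ Γ v n = (ℬ : DesignOfOrder Γ v) → DownLinkedToOrder ℬ n

{-# OPTIONS --safe #-}
module Submission where

open import Defs
open import Data.Empty using (⊥; ⊥-elim)
open import Data.Fin.Base using (Fin; zero; suc; toℕ; fromℕ<)
open import Data.Fin.Patterns
import Data.Fin.Properties as Fin
open import Data.List.Base
  using (List; []; _∷_; [_]; _++_; map; concat; concatMap; length; lookup; tabulate; upTo)
open import Data.List.Membership.Propositional using (_∈_; _∉_; find; lose)
open import Data.List.Membership.Propositional.Properties
  using (∈-∃++; ∈-++⁺ˡ; ∈-++⁺ʳ; ∈-++⁻; ∈-lookup; ∈-concatMap⁺; ∈-concatMap⁻; ∈-map⁺; ∈-map⁻;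
         ∈-tabulate⁺; ∈-tabulate⁻; ∈-upTo⁺; ∈-upTo⁻)
open import Data.List.Properties using (length-++; length-map; ++-assoc; concatMap-++; map-tabulate)
open import Data.List.Relation.Binary.Disjoint.Propositional using (Disjoint)
open import Data.List.Relation.Binary.Permutation.Propositional
  using (_↭_; ↭-refl; ↭-sym; ↭-trans; ↭-prep; ↭-reflexive; ↭⇒↭ₛ)
open import Data.List.Relation.Binary.Permutation.Propositional.Properties
  using (∈-resp-↭; ↭-length; ++⁺; ++⁺ˡ; ++⁺ʳ; shift; shifts; ++-identityʳ; ++-commutativeMonoid)
import Data.List.Relation.Binary.Permutation.Setoid.Properties as ↭ₛ
open import Data.List.Relation.Binary.Subset.Propositional using () renaming (_⊆_ to _⊆ₗ_)
open import Data.List.Relation.Unary.All as All using (All; []; _∷_)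
import Data.List.Relation.Unary.All.Properties as All
open import Data.List.Relation.Unary.AllPairs using ([]; _∷_)
import Data.List.Relation.Unary.AllPairs.Properties as AllPairs
open import Data.List.Relation.Unary.Any using (here; there; any?; index)
open import Data.List.Relation.Unary.Any.Properties using (lookup-index)
open import Data.List.Relation.Unary.Unique.DecPropositional using (unique?)
open import Data.List.Relation.Unary.Unique.Propositional using (Unique)
import Data.List.Relation.Unary.Unique.Propositional.Properties as Unique
open import Data.Maybe.Base as Maybe using (Maybe; just; nothing; from-just)
open import Data.Nat.Base
  using (ℕ; zero; suc; _+_; _*_; _∸_; _⊓_; _⊔_; _≤_; _<_; _≥_; _%_; _/_; z≤n; s≤s)
open import Data.Nat.DivMod using (m≡m%n+[m/n]*n)
open import Data.Nat.Divisibility using (_∣_; divides; ∣m+n∣m⇒∣n; ∣m∣n⇒∣m+n; m∣m*n; _∣?_; _∣0)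
open import Data.Nat.ListAction using (sum)
open import Data.Nat.Properties
open import Data.Nat.Tactic.RingSolver using (solve-∀)
open import Data.Product.Base using (∃-syntax; ∃₂; _×_; _,_; proj₁; proj₂)
open import Data.Product.Properties using (≡-dec)
open import Data.Sum.Base using (_⊎_; inj₁; inj₂; [_,_]′)
open import Function.Base using (_∘_; id)
open import Function.Bundles using (mk⇔; Equivalence)
open import Relation.Binary.PropositionalEquality hiding ([_])
open import Relation.Nullary using (¬_; Dec; yes; no; contradiction; ¬?)
open import Relation.Nullary.Decidable using (_×-dec_; from-no; from-yes; decidable-stable)
open import Relation.Unary using (_⊆_)
open import Algebra.Properties.CommutativeSemigroup +-commutativeSemigroup using (interchange)
open import Data.List.Membership.DecPropositional _≟_ using (_∈?_)

-- Choose a P₄ in every block.  The chosen paths are edge-disjoint, so it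
-- suffices to decompose what they leave uncovered in K_n.  Put two of the new
-- points, p and q, aside: what remains is the join of {p, q}, which are adjacent,
-- with an arbitrary graph E on V (the other new points are part of V), and its
-- size is a multiple of 3 because n ≡ 0, 1 (mod 3).  Such a join is decomposable
-- whenever |V| ≠ 1, by induction:
--   * a P₄ in E can be removed; in a P₄-free graph every edge belongs to a
--     triangle component or has an end of degree one;
--   * a triangle component abc with its six spokes to p and q is p-a-b-q,
--     p-b-c-q, p-c-a-q;
--   * two non-adjacent vertices x, z of degree one with neighbours y, w, with
--     their spokes, are y-x-p-z, w-z-q-x;
--   * three isolated vertices a, b, c with their spokes are a-p-b-q, a-q-c-p.
-- A removal that would leave V with one vertex is replaced by an explicit
-- decomposition of the whole join.

-- Lists: duplicate-freeness, permutations and removal of sublists.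

module _ {A : Set} where

  unique-resp-↭ : {xs ys : List A} → xs ↭ ys → Unique xs → Unique ys
  unique-resp-↭ = ↭ₛ.Unique-resp-↭ (setoid A) ∘ ↭⇒↭ₛ

  unique-++⁻ : ∀ (xs {ys} : List A) → Unique (xs ++ ys) →
               Unique ys × (∀ {z} → z ∈ xs → z ∉ ys)
  unique-++⁻ []       u         = u , λ ()
  unique-++⁻ (x ∷ xs) (x∉ ∷ u) with v , d ← unique-++⁻ xs u = v , λ where
    (here refl) z∈ys → All.lookup x∉ (∈-++⁺ʳ xs z∈ys) refl
    (there z∈xs)     → d z∈xs

  unique⇒lookup-injective : ∀ {xs : List A} → Unique xs →
                            ∀ i j → lookup xs i ≡ lookup xs j → i ≡ j
  unique⇒lookup-injective (x∉ ∷ u) zero    zero    _  = refl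
  unique⇒lookup-injective (x∉ ∷ u) zero    (suc j) eq = contradiction eq (All.lookup x∉ (∈-lookup j))
  unique⇒lookup-injective (x∉ ∷ u) (suc i) zero    eq = contradiction (sym eq) (All.lookup x∉ (∈-lookup i))
  unique⇒lookup-injective (x∉ ∷ u) (suc i) (suc j) eq = cong suc (unique⇒lookup-injective u i j eq)

  ∈-++-delete : ∀ {x z} (as {bs} : List A) → z ∈ as ++ x ∷ bs → x ≢ z → z ∈ as ++ bs
  ∈-++-delete as z∈ x≢z with ∈-++⁻ as z∈
  ... | inj₁ z∈as         = ∈-++⁺ˡ z∈as
  ... | inj₂ (here refl)  = contradiction refl x≢z
  ... | inj₂ (there z∈bs) = ∈-++⁺ʳ as z∈bs

  -- List difference. As `xs` has no repetitions, membership alone ensures that its elements can be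
  -- taken out of `ys` one after another.
  complement : ∀ {xs ys : List A} → Unique xs → xs ⊆ₗ ys → ∃[ zs ] ys ↭ xs ++ zs
  complement {[]}     {ys} _        _     = ys , ↭-refl
  complement {x ∷ xs} {ys} (x∉ ∷ u) xs⊆ys
    with as , bs , refl ← ∈-∃++ (xs⊆ys (here refl))
    with zs , σ ← complement {xs} {as ++ bs} u
                    (λ z∈xs → ∈-++-delete as (xs⊆ys (there z∈xs)) (All.lookup x∉ z∈xs))
    = zs , ↭-trans (shift x as bs) (↭-prep x σ)

  concatMap-↭ : {B : Set} (f : A → List B) {xs ys : List A} → xs ↭ ys → concatMap f xs ↭ concatMap f ys
  concatMap-↭ f _↭_.refl         = ↭-refl
  concatMap-↭ f (_↭_.prep x σ)   = ++⁺ˡ (f x) (concatMap-↭ f σ)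
  concatMap-↭ f (_↭_.swap x y σ) =
    ↭-trans (shifts (f x) (f y)) (++⁺ˡ (f y) (++⁺ˡ (f x) (concatMap-↭ f σ)))
  concatMap-↭ f (_↭_.trans σ τ)  = ↭-trans (concatMap-↭ f σ) (concatMap-↭ f τ)

-- Edges, four-vertex paths and decompositions of edge lists.

Edge : Set
Edge = ℕ × ℕ

-- Ordering the endpoints makes the two orientations of an edge propositionally equal.
edge : ℕ → ℕ → Edge
edge x y = x ⊓ y , x ⊔ y

edge-comm : ∀ x y → edge x y ≡ edge y x
edge-comm x y = cong₂ _,_ (⊓-comm x y) (⊔-comm x y)

edge-injective : ∀ a b c d → edge a b ≡ edge c d → (a ≡ c × b ≡ d) ⊎ (a ≡ d × b ≡ c)
edge-injective a b c d eq with ≤-total a b | ≤-total c d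
... | inj₁ p | inj₁ q
  rewrite m≤n⇒m⊓n≡m p | m≤n⇒m⊔n≡n p | m≤n⇒m⊓n≡m q | m≤n⇒m⊔n≡n q
  = inj₁ (cong proj₁ eq , cong proj₂ eq)
... | inj₁ p | inj₂ q
  rewrite m≤n⇒m⊓n≡m p | m≤n⇒m⊔n≡n p | m≥n⇒m⊓n≡n q | m≥n⇒m⊔n≡m q
  = inj₂ (cong proj₁ eq , cong proj₂ eq)
... | inj₂ p | inj₁ q
  rewrite m≥n⇒m⊓n≡n p | m≥n⇒m⊔n≡m p | m≤n⇒m⊓n≡m q | m≤n⇒m⊔n≡n q
  = inj₂ (cong proj₂ eq , cong proj₁ eq)
... | inj₂ p | inj₂ q
  rewrite m≥n⇒m⊓n≡n p | m≥n⇒m⊔n≡m p | m≥n⇒m⊓n≡n q | m≥n⇒m⊔n≡m q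
  = inj₁ (cong proj₂ eq , cong proj₁ eq)

edge-injectiveʳ : ∀ a {b c} → edge a b ≡ edge a c → b ≡ c
edge-injectiveʳ a {b} {c} eq with edge-injective a b a c eq
... | inj₁ (_ , b≡c)    = b≡c
... | inj₂ (refl , b≡a) = b≡a

_≟ᴱ_ : (e f : Edge) → Dec (e ≡ f)
_≟ᴱ_ = ≡-dec _≟_ _≟_

open import Data.List.Membership.DecPropositional _≟ᴱ_
  using () renaming (_∈?_ to _∈ᴱ?_)

record Path : Set where
  constructor mkPath
  field
    a b c d  : ℕ
    distinct : Unique (a ∷ b ∷ c ∷ d ∷ [])

  edges : List Edge
  edges = edge a b ∷ edge b c ∷ edge c d ∷ []

  edges-unique : Unique edges
  edges-unique with distinct
  ... | (a≢b ∷ a≢c ∷ a≢d ∷ []) ∷ (b≢c ∷ b≢d ∷ []) ∷ (c≢d ∷ []) ∷ [] ∷ [] =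
    ([ a≢b ∘ proj₁ , a≢c ∘ proj₁ ]′ ∘ edge-injective a b b c ∷
     [ a≢c ∘ proj₁ , a≢d ∘ proj₁ ]′ ∘ edge-injective a b c d ∷ []) ∷
    ([ b≢c ∘ proj₁ , b≢d ∘ proj₁ ]′ ∘ edge-injective b c c d ∷ []) ∷ [] ∷ []

open Path public using (edges; edges-unique)

-- A permutation respects multiplicities, so for a duplicate-free `es` the paths are automatically
-- edge-disjoint.
Decomposable : List Edge → Set
Decomposable es = ∃[ ps ] es ↭ concatMap edges ps

decomposable-resp-↭ : ∀ {es fs} → es ↭ fs → Decomposable fs → Decomposable es
decomposable-resp-↭ σ (ps , τ) = ps , ↭-trans σ τ

decomposable-++ : ∀ {es fs} → Decomposable es → Decomposable fs → Decomposable (es ++ fs)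
decomposable-++ (ps , σ) (qs , τ) =
  ps ++ qs , ↭-trans (++⁺ σ τ) (↭-reflexive (sym (concatMap-++ edges ps qs)))

decomposable-path : ∀ p → Decomposable (edges p)
decomposable-path p = [ p ] , ↭-refl

3∣length-paths : ∀ ps → 3 ∣ length (concatMap edges ps)
3∣length-paths ps = divides (length ps) (go ps)
  where
  go : ∀ ps → length (concatMap edges ps) ≡ length ps * 3
  go []       = refl
  go (p ∷ ps) = cong (3 +_) (go ps)

decomposable⇒3∣length : ∀ {es} → Decomposable es → 3 ∣ length es
decomposable⇒3∣length (ps , σ) = subst (3 ∣_) (sym (↭-length σ)) (3∣length-paths ps)

-- Decompositions of small graphs on distinct vertices xs, checked by
-- computation on the positions of the vertices.
module Gadget (xs : List ℕ) (uxs : Unique xs) where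

  Arc Quad : Set
  Arc  = Fin (length xs) × Fin (length xs)
  Quad = Fin (length xs) × Fin (length xs) × Fin (length xs) × Fin (length xs)

  place : Arc → Edge
  place (i , j) = edge (lookup xs i) (lookup xs j)

  _≟ᴬ_ : (e f : Arc) → Dec (e ≡ f)
  _≟ᴬ_ = ≡-dec Fin._≟_ Fin._≟_

  -- The arc may be found in either direction, because `place` forgets orientation.
  extract : ∀ e fs → Maybe (∃[ gs ] map place fs ↭ place e ∷ map place gs)
  extract e       []       = nothing
  extract (i , j) (f ∷ fs) with f ≟ᴬ (i , j) | f ≟ᴬ (j , i)
  ... | yes refl | _        = just (fs , ↭-refl)
  ... | no _     | yes refl = just (fs , ↭-reflexive (cong (_∷ map place fs) (edge-comm (lookup xs j) (lookup xs i))))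
  ... | no _     | no _     with extract (i , j) fs
  ...   | nothing       = nothing
  ...   | just (gs , σ) = just (f ∷ gs , ↭-trans (↭-prep (place f) σ) (shift (place (i , j)) [ place f ] (map place gs)))

  match : ∀ es fs → Maybe (map place fs ↭ map place es)
  match []       []      = just ↭-refl
  match []       (_ ∷ _) = nothing
  match (e ∷ es) fs      with extract e fs
  ... | nothing       = nothing
  ... | just (gs , σ) = Maybe.map (↭-trans σ ∘ ↭-prep (place e)) (match es gs)

  arcs : List Quad → List Arc
  arcs = concatMap λ (i , j , k , l) → (i , j) ∷ (j , k) ∷ (k , l) ∷ []

  paths : (qs : List Quad) → Maybe (Decomposable (map place (arcs qs)))
  paths []                       = just ([] , ↭-refl)
  paths ((i , j , k , l) ∷ qs) with unique? Fin._≟_ (i ∷ j ∷ k ∷ l ∷ [])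
  ... | no _  = nothing
  ... | yes u = Maybe.map (decomposable-++ (decomposable-path
                  (mkPath _ _ _ _ (Unique.map⁺ (unique⇒lookup-injective uxs _ _) u)))) (paths qs)

  -- Here `qs` is a proposed decomposition of `es`. Uses go through `from-just`, which has the
  -- wanted type only if the check evaluates to `just`; the test compares positions alone, so it
  -- evaluates while the vertices stay variables.
  decompose : (qs : List Quad) (es : List Arc) → Maybe (Decomposable (map place es))
  decompose qs es with match (arcs qs) es | paths qs
  ... | just σ  | just D = just (decomposable-resp-↭ σ D)
  ... | _       | _      = nothing

-- The join of two adjacent vertices with an arbitrary graph.

record Spans (V : List ℕ) (e : Edge) : Set where
  constructor spans
  field
    {x y} : ℕ
    x∈V   : x ∈ V
    y∈V   : y ∈ V
    x≢y   : x ≢ y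
    e≡xy  : e ≡ edge x y

module Join (p q : ℕ) where

  spokes : List ℕ → List Edge
  spokes = concatMap λ x → edge x p ∷ edge x q ∷ []

  join : List ℕ → List Edge → List Edge
  join V E = edge p q ∷ spokes V ++ E

  -- `E` is the edge list of a simple graph on `V`, and `p`, `q` are two distinct vertices outside
  -- it.
  record Config (V : List ℕ) (E : List Edge) : Set where
    field
      uniqueⱽ : Unique (p ∷ q ∷ V)
      uniqueᴱ : Unique E
      spanned         : ∀ {e} → e ∈ E → Spans V e
  open Config

  join-↭ : ∀ {V V′ E E′} → V ↭ V′ → E ↭ E′ → join V E ↭ join V′ E′
  join-↭ σ τ = ↭-prep (edge p q) (++⁺ (concatMap-↭ _ σ) τ)

  length-join : ∀ V E → length (join V E) ≡ suc (2 * length V + length E)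
  length-join V E = cong suc (trans (length-++ (spokes V)) (cong (_+ length E) (go V)))
    where
    go : ∀ V → length (spokes V) ≡ 2 * length V
    go []      = refl
    go (_ ∷ V) = trans (cong (2 +_) (go V)) (sym (*-suc 2 (length V)))

  open import Algebra.Solver.CommutativeMonoid (++-commutativeMonoid {A = Edge})
    using (_⊜_; _⊕_) renaming (solve to solve-↭)

  join-++ : ∀ ps V es E → join (ps ++ V) (es ++ E) ↭ (spokes ps ++ es) ++ join V E
  join-++ ps V es E rewrite concatMap-++ (λ x → edge x p ∷ edge x q ∷ []) ps V =
    solve-↭ 5 (λ pq sp sV es E → pq ⊕ (sp ⊕ sV) ⊕ es ⊕ E ⊜ (sp ⊕ es) ⊕ pq ⊕ sV ⊕ E)
      ↭-refl [ edge p q ] (spokes ps) (spokes V) es E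

  -- Ensures that deleting the vertices `ps` and the edges `es` leaves no edge with a deleted end.
  Closed : List ℕ → List Edge → List Edge → Set
  Closed ps es E = ∀ {x y} → x ∈ ps → edge x y ∈ E → edge x y ∈ es

  restrict : ∀ {V E V′ E′} ps es → Config V E → V ↭ ps ++ V′ → E ↭ es ++ E′ →
             Closed ps es E → Config V′ E′
  restrict {V} {E} {V′} {E′} ps es C σ τ closed with uniqueⱽ C
  ... | (p≢q ∷ p∉V) ∷ q∉V ∷ uV = record
    { uniqueⱽ = (p≢q ∷ weaken p∉V) ∷ weaken q∉V ∷ proj₁ (unique-++⁻ ps (unique-resp-↭ σ uV))
    ; uniqueᴱ = proj₁ es++E′-unique
    ; spanned         = spanned′
    }
    where
    weaken : ∀ {z} → All (z ≢_) V → All (z ≢_) V′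
    weaken z∉V = All.tabulate λ w∈V′ → All.lookup z∉V (∈-resp-↭ (↭-sym σ) (∈-++⁺ʳ ps w∈V′))

    es++E′-unique = unique-++⁻ es (unique-resp-↭ τ (uniqueᴱ C))

    kept : ∀ {x y} → edge x y ∈ E′ → x ∈ V → x ∈ V′
    kept {x} {y} e∈E′ x∈V with ∈-++⁻ ps (∈-resp-↭ σ x∈V)
    ... | inj₂ x∈V′ = x∈V′
    -- A surviving edge at a deleted vertex would be in `es` by closedness, and `E` would contain it
    -- twice.
    ... | inj₁ x∈ps = ⊥-elim (proj₂ es++E′-unique (closed x∈ps (∈-resp-↭ (↭-sym τ) (∈-++⁺ʳ es e∈E′))) e∈E′)

    spanned′ : ∀ {e} → e ∈ E′ → Spans V′ e
    spanned′ e∈E′ with spanned C (∈-resp-↭ (↭-sym τ) (∈-++⁺ʳ es e∈E′))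
    ... | spans {x} {y} x∈V y∈V x≢y refl =
      spans (kept e∈E′ x∈V) (kept (subst (_∈ E′) (edge-comm x y) e∈E′) y∈V) x≢y refl

  no-edges-on-[_] : ∀ d {E} → Config [ d ] E → E ≡ []
  no-edges-on-[ d ] {[]}    C = refl
  no-edges-on-[ d ] {e ∷ E} C with spanned C (here refl)
  ... | spans (here refl) (here refl) x≢y _ = contradiction refl x≢y

  -- The join with a single vertex is a triangle: its size is divisible by 3, yet it contains no P₄.
  -- Hence the condition on `length V`.
  Solvable : List ℕ → List Edge → Set
  Solvable V E = Config V E → length V ≢ 1 → 3 ∣ length (join V E) → Decomposable (join V E)

  SolvableBelow : ℕ → Set
  SolvableBelow n = ∀ V E → length V + length E < n → Solvable V E

  -- Splits off the vertices ps together with their spokes and the edges es,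
  -- unless this would leave a single vertex d, for which the join is a triangle.
  reduce : ∀ {V E} ps es → SolvableBelow (length V + length E) → Config V E →
           3 ∣ length (join V E) → 0 < length ps + length es →
           Unique ps → ps ⊆ₗ V → Unique es → es ⊆ₗ E → Closed ps es E →
           Decomposable (spokes ps ++ es) →
           (∀ d → V ↭ ps ++ [ d ] → Decomposable (join (ps ++ [ d ]) es)) →
           Decomposable (join V E)
  reduce {V} {E} ps es IH C 3∣ pos ups ps⊆V ues es⊆E closed D base
    with V′ , σ ← complement ups ps⊆V
    with E′ , τ ← complement ues es⊆E
    = go V′ σ (restrict ps es C σ τ closed)
    where
    whole : ∀ V′ → V ↭ ps ++ V′ → join V E ↭ (spokes ps ++ es) ++ join V′ E′
    whole V′ σ = ↭-trans (join-↭ σ τ) (join-++ ps V′ es E′)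

    smaller : ∀ V′ → V ↭ ps ++ V′ → length V′ + length E′ < length V + length E
    smaller V′ σ = begin-strict
      length V′ + length E′
        <⟨ +-monoˡ-< _ pos ⟩
      (length ps + length es) + (length V′ + length E′)
        ≡⟨ interchange (length ps) (length es) (length V′) (length E′) ⟩
      (length ps + length V′) + (length es + length E′)
        ≡⟨ cong₂ _+_ (trans (sym (length-++ ps)) (sym (↭-length σ)))
                     (trans (sym (length-++ es)) (sym (↭-length τ))) ⟩
      length V + length E ∎
      where open ≤-Reasoning

    go : ∀ V′ → V ↭ ps ++ V′ → Config V′ E′ → Decomposable (join V E)
    go V′ σ C′ with length V′ ≟ 1
    -- The removed part is decomposable, so its size is a multiple of 3 and divisibility passes to
    -- the smaller join.
    ... | no ≢1 = decomposable-resp-↭ (whole V′ σ) (decomposable-++ D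
                    (IH V′ E′ (smaller V′ σ) C′ ≢1
                      (∣m+n∣m⇒∣n (subst (3 ∣_) (trans (↭-length (whole V′ σ)) (length-++ (spokes ps ++ es))) 3∣)
                                 (decomposable⇒3∣length D))))
    -- One vertex carries no edge, so `E` consists of `es` alone and `base` applies to the whole
    -- join.
    go (d ∷ []) σ C′ | yes _ with no-edges-on-[ d ] C′
    ... | refl = decomposable-resp-↭ (join-↭ σ (↭-trans τ (++-identityʳ es))) (base d σ)

  endpoints : ∀ {V E x y} → Config V E → edge x y ∈ E → x ∈ V × y ∈ V × x ≢ y
  endpoints {x = x} {y} C xy∈E with spanned C xy∈E
  ... | spans {u} {w} u∈V w∈V u≢w eq with edge-injective x y u w eq
  ...   | inj₁ (refl , refl) = u∈V , w∈V , u≢w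
  ...   | inj₂ (refl , refl) = w∈V , u∈V , u≢w ∘ sym

  flip-∈ : ∀ {E} x y → edge x y ∈ E → edge y x ∈ E
  flip-∈ x y = subst (_∈ _) (edge-comm x y)

  -- All neighbours of `x` lie in `V`, so a search through `V` decides the alternative.
  neighbour∉ : ∀ {V E} → Config V E → ∀ x ys →
               (∃[ z ] edge x z ∈ E × z ∉ ys) ⊎ (∀ {z} → edge x z ∈ E → z ∈ ys)
  neighbour∉ {V} {E} C x ys with any? (λ z → edge x z ∈ᴱ? E ×-dec ¬? (z ∈? ys)) V
  ... | yes found = let z , _ , h = find found in inj₁ (z , h)
  ... | no  none  = inj₂ λ {z} xz∈E → decidable-stable (z ∈? ys) λ z∉ys →
                      none (lose (proj₁ (proj₂ (endpoints C xz∈E))) (xz∈E , z∉ys))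

  -- Paths, triangle components and leaves around an edge.

  data Shape (V : List ℕ) (E : List Edge) (e : Edge) : Set where
    hasPath     : ∀ P → edges P ⊆ₗ E → Shape V E e
    hasTriangle : ∀ a b c → Unique (a ∷ b ∷ c ∷ []) → a ∷ b ∷ c ∷ [] ⊆ₗ V →
                  let es = edge a b ∷ edge b c ∷ edge c a ∷ [] in
                  es ⊆ₗ E → Closed (a ∷ b ∷ c ∷ []) es E → Shape V E e
    hasLeaf     : ∀ x y → e ≡ edge x y → (∀ {z} → edge x z ∈ E → z ≡ y) → Shape V E e

  singleton⁻ : ∀ {x y : ℕ} → x ∈ [ y ] → x ≡ y
  singleton⁻ (here eq) = eq

  -- Consecutive vertices differ because `E` has no loops; only the other three inequalities have to
  -- be supplied.
  walk : ∀ {V E e} → Config V E → ∀ a b c d → edge a b ∈ E → edge b c ∈ E → edge c d ∈ E →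
         a ≢ c → a ≢ d → b ≢ d → Shape V E e
  walk C a b c d ab bc cd a≢c a≢d b≢d =
    hasPath (mkPath a b c d ((≢ ab ∷ a≢c ∷ a≢d ∷ []) ∷ (≢ bc ∷ b≢d ∷ []) ∷ (≢ cd ∷ []) ∷ [] ∷ []))
         (All.lookup (ab ∷ bc ∷ cd ∷ []))
    where
    ≢ : ∀ {x y} → edge x y ∈ _ → x ≢ y
    ≢ = proj₂ ∘ proj₂ ∘ endpoints C

  -- If neither end is a leaf, `x` has a further neighbour `u` and `y` a further neighbour `w`. For
  -- `u ≢ w` the path is u-x-y-w. Otherwise x, y, u form a triangle, and a neighbour `r` of a corner
  -- outside it starts a path that enters at that corner and runs round the other two. Without such
  -- an `r` the triangle is a component.
  classify : ∀ {V E} → Config V E → ∀ x y → edge x y ∈ E → Shape V E (edge x y)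
  classify {V} {E} C x y xy with neighbour∉ C x [ y ]
  ... | inj₂ only-y = hasLeaf x y refl (singleton⁻ ∘ only-y)
  ... | inj₁ (u , xu , u∉y) with neighbour∉ C y [ x ]
  ...   | inj₂ only-x = hasLeaf y x (edge-comm x y) (singleton⁻ ∘ only-x)
  ...   | inj₁ (w , yw , w∉x) with u ≟ w
  ...     | no u≢w = walk C u x y w (flip-∈ x u xu) xy yw (u∉y ∘ here) u≢w (w∉x ∘ here ∘ sym)
  ...     | yes refl with neighbour∉ C x (y ∷ u ∷ []) | neighbour∉ C y (x ∷ u ∷ []) | neighbour∉ C u (x ∷ y ∷ [])
  ...       | inj₁ (r , xr , r∉) | _ | _ =
              walk C r x y u (flip-∈ x r xr) xy yw (r∉ ∘ here) (r∉ ∘ there ∘ here) (w∉x ∘ here ∘ sym)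
  ...       | inj₂ _ | inj₁ (r , yr , r∉) | _ =
              walk C r y x u (flip-∈ y r yr) (flip-∈ x y xy) xu (r∉ ∘ here) (r∉ ∘ there ∘ here) (u∉y ∘ here ∘ sym)
  ...       | inj₂ _ | inj₂ _ | inj₁ (r , ur , r∉) =
              walk C r u x y (flip-∈ u r ur) (flip-∈ x u xu) xy (r∉ ∘ here) (r∉ ∘ there ∘ here) (u∉y ∘ here)
  ...       | inj₂ fromx | inj₂ fromy | inj₂ fromu
              with x∈V , y∈V , x≢y ← endpoints C xy | _ , u∈V , y≢u ← endpoints C yw =
              hasTriangle x y u ((x≢y ∷ w∉x ∘ here ∘ sym ∷ []) ∷ (y≢u ∷ []) ∷ [] ∷ [])
                (All.lookup (x∈V ∷ y∈V ∷ u∈V ∷ [])) (All.lookup (xy ∷ yw ∷ flip-∈ x u xu ∷ [])) closed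
    where
    closed : Closed (x ∷ y ∷ u ∷ []) (edge x y ∷ edge y u ∷ edge u x ∷ []) E
    closed (here refl) xz with fromx xz
    ... | here refl         = here refl
    ... | there (here refl) = there (there (here (edge-comm x u)))
    closed (there (here refl)) yz with fromy yz
    ... | here refl         = here (edge-comm y x)
    ... | there (here refl) = there (here refl)
    closed (there (there (here refl))) uz with fromu uz
    ... | here refl         = there (there (here refl))
    ... | there (here refl) = there (here (edge-comm u y))

  -- The removable pieces: a path, three isolated vertices, a triangle, two leaves.

  unique-⊆ : ∀ {V ps} → Unique (p ∷ q ∷ V) → Unique ps → ps ⊆ₗ V → Unique (p ∷ q ∷ ps)
  unique-⊆ ((p≢q ∷ p∉V) ∷ q∉V ∷ _) ups ps⊆V =
    (p≢q ∷ All.tabulate (All.lookup p∉V ∘ ps⊆V)) ∷ All.tabulate (All.lookup q∉V ∘ ps⊆V) ∷ ups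

  unique-↭ : ∀ {V W} → Unique (p ∷ q ∷ V) → V ↭ W → Unique (p ∷ q ∷ W)
  unique-↭ u σ = unique-resp-↭ (↭-prep p (↭-prep q σ)) u

  solve-path : ∀ {V E} → SolvableBelow (length V + length E) → Config V E → length V ≢ 1 →
               3 ∣ length (join V E) → ∀ P → edges P ⊆ₗ E → Decomposable (join V E)
  solve-path IH C ≢1 3∣ P P⊆E =
    reduce [] (edges P) IH C 3∣ (s≤s z≤n) [] (λ ()) (edges-unique P) P⊆E (λ ())
      -- No vertex is removed, so a one-vertex remainder would be `V` itself.
      (decomposable-path P) (λ d σ → contradiction (↭-length σ) ≢1)

  solve-isolated : ∀ {V E} → SolvableBelow (length V + length E) → Config V E →
                   3 ∣ length (join V E) → ∀ a b c → Unique (a ∷ b ∷ c ∷ []) → a ∷ b ∷ c ∷ [] ⊆ₗ V →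
                   Closed (a ∷ b ∷ c ∷ []) [] E → Decomposable (join V E)
  solve-isolated IH C 3∣ a b c u abc⊆V closed =
    reduce (a ∷ b ∷ c ∷ []) [] IH C 3∣ (s≤s z≤n) u abc⊆V [] (λ ()) closed
      -- In every gadget below positions `0F` and `1F` are `p` and `q`, and the vertices of `V`
      -- follow in the listed order.
      (from-just (Gadget.decompose (p ∷ q ∷ a ∷ b ∷ c ∷ []) (unique-⊆ (uniqueⱽ C) u abc⊆V)
        ((2F , 0F , 3F , 1F) ∷ (2F , 1F , 4F , 0F) ∷ [])
        ((2F , 0F) ∷ (2F , 1F) ∷ (3F , 0F) ∷ (3F , 1F) ∷ (4F , 0F) ∷ (4F , 1F) ∷ [])))
      -- Four isolated vertices, now with the edge pq: a-p-q-b, b-p-c-q, a-q-d-p.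
      λ d σ → from-just (Gadget.decompose (p ∷ q ∷ a ∷ b ∷ c ∷ d ∷ []) (unique-↭ (uniqueⱽ C) σ)
        ((2F , 0F , 1F , 3F) ∷ (3F , 0F , 4F , 1F) ∷ (2F , 1F , 5F , 0F) ∷ [])
        ((0F , 1F) ∷ (2F , 0F) ∷ (2F , 1F) ∷ (3F , 0F) ∷ (3F , 1F) ∷ (4F , 0F) ∷ (4F , 1F) ∷
         (5F , 0F) ∷ (5F , 1F) ∷ []))

  solve-triangle : ∀ {V E} → SolvableBelow (length V + length E) → Config V E →
                   3 ∣ length (join V E) → ∀ a b c → Unique (a ∷ b ∷ c ∷ []) → a ∷ b ∷ c ∷ [] ⊆ₗ V →
                   let es = edge a b ∷ edge b c ∷ edge c a ∷ [] in
                   es ⊆ₗ E → Closed (a ∷ b ∷ c ∷ []) es E → Decomposable (join V E)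
  solve-triangle IH C 3∣ a b c u@((a≢b ∷ a≢c ∷ []) ∷ (b≢c ∷ []) ∷ [] ∷ []) abc⊆V es⊆E closed =
    reduce (a ∷ b ∷ c ∷ []) _ IH C 3∣ (s≤s z≤n) u abc⊆V
      (([ a≢b ∘ proj₁ , a≢c ∘ proj₁ ]′ ∘ edge-injective a b b c ∷
        [ a≢c ∘ proj₁ , b≢c ∘ proj₂ ]′ ∘ edge-injective a b c a ∷ []) ∷
       ([ b≢c ∘ proj₁ , a≢b ∘ sym ∘ proj₁ ]′ ∘ edge-injective b c c a ∷ []) ∷ [] ∷ [])
      es⊆E closed
      (from-just (Gadget.decompose (p ∷ q ∷ a ∷ b ∷ c ∷ []) (unique-⊆ (uniqueⱽ C) u abc⊆V)
        ((0F , 2F , 3F , 1F) ∷ (0F , 3F , 4F , 1F) ∷ (0F , 4F , 2F , 1F) ∷ [])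
        ((2F , 0F) ∷ (2F , 1F) ∷ (3F , 0F) ∷ (3F , 1F) ∷ (4F , 0F) ∷ (4F , 1F) ∷
         (2F , 3F) ∷ (3F , 4F) ∷ (4F , 2F) ∷ [])))
      -- The paths p-b-c-q and p-c-a-q stay; the edges of p-a-b-q, together with pd, dq and pq, are
      -- rearranged into a-p-d-q and a-b-q-p.
      λ d σ → from-just (Gadget.decompose (p ∷ q ∷ a ∷ b ∷ c ∷ d ∷ []) (unique-↭ (uniqueⱽ C) σ)
        ((2F , 0F , 5F , 1F) ∷ (2F , 3F , 1F , 0F) ∷ (0F , 3F , 4F , 1F) ∷ (0F , 4F , 2F , 1F) ∷ [])
        ((0F , 1F) ∷ (2F , 0F) ∷ (2F , 1F) ∷ (3F , 0F) ∷ (3F , 1F) ∷ (4F , 0F) ∷ (4F , 1F) ∷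
         (5F , 0F) ∷ (5F , 1F) ∷ (2F , 3F) ∷ (3F , 4F) ∷ (4F , 2F) ∷ []))

  solve-leaves : ∀ {V E} → SolvableBelow (length V + length E) → Config V E →
                 3 ∣ length (join V E) → ∀ x y z w → edge x y ∈ E → edge z w ∈ E →
                 (∀ {v} → edge x v ∈ E → v ≡ y) → (∀ {v} → edge z v ∈ E → v ≡ w) →
                 x ≢ z → x ≢ w → z ≢ y → Decomposable (join V E)
  solve-leaves {V} {E} IH C 3∣ x y z w xy zw only-y only-w x≢z x≢w z≢y
    with x∈V , y∈V , x≢y ← endpoints C xy | z∈V , w∈V , z≢w ← endpoints C zw =
    reduce (x ∷ z ∷ []) (edge x y ∷ edge z w ∷ []) IH C 3∣ (s≤s z≤n)
      ((x≢z ∷ []) ∷ [] ∷ []) (All.lookup (x∈V ∷ z∈V ∷ []))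
      (([ x≢z ∘ proj₁ , x≢w ∘ proj₁ ]′ ∘ edge-injective x y z w ∷ []) ∷ [] ∷ [])
      (All.lookup (xy ∷ zw ∷ []))
      (λ { (here refl) xv → here (cong (edge x) (only-y xv))
         ; (there (here refl)) zv → there (here (cong (edge z) (only-w zv))) })
      body
      base
    where
    body : Decomposable (spokes (x ∷ z ∷ []) ++ edge x y ∷ edge z w ∷ [])
    -- The leaves may share their neighbour. Gadget vertices must be distinct, so that neighbour is
    -- then listed once.
    body with y ≟ w
    ... | yes refl = from-just (Gadget.decompose (p ∷ q ∷ x ∷ z ∷ y ∷ [])
            (unique-⊆ (uniqueⱽ C) ((x≢z ∷ x≢y ∷ []) ∷ (z≢y ∷ []) ∷ [] ∷ []) (All.lookup (x∈V ∷ z∈V ∷ y∈V ∷ [])))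
            ((4F , 2F , 0F , 3F) ∷ (4F , 3F , 1F , 2F) ∷ [])
            ((2F , 0F) ∷ (2F , 1F) ∷ (3F , 0F) ∷ (3F , 1F) ∷ (2F , 4F) ∷ (3F , 4F) ∷ []))
    ... | no y≢w = from-just (Gadget.decompose (p ∷ q ∷ x ∷ z ∷ y ∷ w ∷ [])
            (unique-⊆ (uniqueⱽ C)
              ((x≢z ∷ x≢y ∷ x≢w ∷ []) ∷ (z≢y ∷ z≢w ∷ []) ∷ (y≢w ∷ []) ∷ [] ∷ [])
              (All.lookup (x∈V ∷ z∈V ∷ y∈V ∷ w∈V ∷ [])))
            ((4F , 2F , 0F , 3F) ∷ (5F , 3F , 1F , 2F) ∷ [])
            ((2F , 0F) ∷ (2F , 1F) ∷ (3F , 0F) ∷ (3F , 1F) ∷ (2F , 4F) ∷ (3F , 5F) ∷ []))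

    third : ∀ {d v} → v ∈ x ∷ z ∷ d ∷ [] → x ≢ v → z ≢ v → v ≡ d
    third (here refl)                 x≢v _   = contradiction refl x≢v
    third (there (here refl))         _   z≢v = contradiction refl z≢v
    third (there (there (here refl))) _   _   = refl

    base : ∀ d → V ↭ x ∷ z ∷ d ∷ [] → Decomposable (join (x ∷ z ∷ d ∷ []) (edge x y ∷ edge z w ∷ []))
    -- With only three vertices, both leaves hang on `d`. The paths are x-d-p-q, z-d-q-x, x-p-z-q.
    base d σ with refl ← third (∈-resp-↭ σ y∈V) x≢y z≢y | refl ← third (∈-resp-↭ σ w∈V) x≢w z≢w =
      from-just (Gadget.decompose (p ∷ q ∷ x ∷ z ∷ d ∷ []) (unique-↭ (uniqueⱽ C) σ)
        ((2F , 4F , 0F , 1F) ∷ (3F , 4F , 1F , 2F) ∷ (2F , 0F , 3F , 1F) ∷ [])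
        ((0F , 1F) ∷ (2F , 0F) ∷ (2F , 1F) ∷ (3F , 0F) ∷ (3F , 1F) ∷ (4F , 0F) ∷ (4F , 1F) ∷
         (2F , 4F) ∷ (3F , 4F) ∷ []))

  -- The induction, split by the number of edges of `E`.

  solve-edgeless : ∀ V → SolvableBelow (length V + 0) → Solvable V []
  -- With zero or two isolated vertices the join has 1 or 5 edges, against divisibility by 3.
  solve-edgeless []                  IH C ≢1 3∣ = contradiction 3∣ (from-no (3 ∣? 1))
  solve-edgeless (_ ∷ [])            IH C ≢1 3∣ = contradiction refl ≢1
  solve-edgeless (_ ∷ _ ∷ [])        IH C ≢1 3∣ = contradiction 3∣ (from-no (3 ∣? 5))
  solve-edgeless (a ∷ b ∷ c ∷ V)     IH C ≢1 3∣ with uniqueⱽ C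
  ... | _ ∷ _ ∷ (a≢b ∷ a≢c ∷ _) ∷ (b≢c ∷ _) ∷ _ =
    solve-isolated IH C 3∣ a b c ((a≢b ∷ a≢c ∷ []) ∷ (b≢c ∷ []) ∷ [] ∷ [])
      (∈-++⁺ˡ {xs = a ∷ b ∷ c ∷ []}) λ _ ()

  -- The two leaves of a single edge are adjacent, so the leaf removal does not apply. Instead, all
  -- vertices off the edge are isolated, and three of them can be removed unless `V` is small.
  solve-one-edge : ∀ V x y → SolvableBelow (length V + 1) → Solvable V [ edge x y ]
  solve-one-edge V x y IH C ≢1 3∣
    with x∈V , y∈V , x≢y ← endpoints C (here refl)
    with V′ , σ ← complement ((x≢y ∷ []) ∷ [] ∷ []) (All.lookup (x∈V ∷ y∈V ∷ []))
    = go V′ σ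
    where
    counted : ∀ {n} → length V ≡ n → 3 ∣ suc (2 * n + 1)
    counted refl = subst (3 ∣_) (length-join V [ edge x y ]) 3∣

    go : ∀ V′ → V ↭ x ∷ y ∷ V′ → Decomposable (join V [ edge x y ])
    -- The join is K₄, decomposed as p-q-x-y and q-y-p-x.
    go [] σ = decomposable-resp-↭ (join-↭ σ ↭-refl)
      (from-just (Gadget.decompose (p ∷ q ∷ x ∷ y ∷ []) (unique-↭ (uniqueⱽ C) σ)
        ((0F , 1F , 2F , 3F) ∷ (1F , 3F , 0F , 2F) ∷ [])
        ((0F , 1F) ∷ (2F , 0F) ∷ (2F , 1F) ∷ (3F , 0F) ∷ (3F , 1F) ∷ (2F , 3F) ∷ [])))
    -- Three or four vertices in `V` would give 8 or 10 edges.
    go (_ ∷ [])     σ = contradiction (counted (↭-length σ)) (from-no (3 ∣? 8))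
    go (_ ∷ _ ∷ []) σ = contradiction (counted (↭-length σ)) (from-no (3 ∣? 10))
    go (a ∷ b ∷ c ∷ V′) σ with unique-↭ (uniqueⱽ C) σ
    ... | _ ∷ _ ∷ (_ ∷ x≢a ∷ x≢b ∷ x≢c ∷ _) ∷ (y≢a ∷ y≢b ∷ y≢c ∷ _) ∷ (a≢b ∷ a≢c ∷ _) ∷ (b≢c ∷ _) ∷ _ =
      solve-isolated IH C 3∣ a b c ((a≢b ∷ a≢c ∷ []) ∷ (b≢c ∷ []) ∷ [] ∷ [])
        (λ z∈ → ∈-resp-↭ (↭-sym σ) (there (there (∈-++⁺ˡ z∈))))
        λ { (here refl) → apart x≢a y≢a ; (there (here refl)) → apart x≢b y≢b
          ; (there (there (here refl))) → apart x≢c y≢c }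
      where
      apart : ∀ {v w} → x ≢ v → y ≢ v → edge v w ∈ [ edge x y ] → edge v w ∈ []
      apart {v} {w} x≢v y≢v (here eq) =
        ⊥-elim ([ x≢v ∘ sym ∘ proj₁ , y≢v ∘ sym ∘ proj₁ ]′ (edge-injective v w x y eq))

  -- Two edges are enough to find a removable piece: failing a path or a triangle, each has a leaf.
  -- If these leaves coincided or were adjacent, the uniqueness of their neighbours would force `e`
  -- and `f` to be equal.
  solve-two-edges : ∀ V e f E → SolvableBelow (length V + length (e ∷ f ∷ E)) → Solvable V (e ∷ f ∷ E)
  solve-two-edges V e f E IH C ≢1 3∣
    with spans {x₁} {y₁} _ _ _ refl ← spanned C (here refl)
    with spans {x₂} {y₂} _ _ _ refl ← spanned C (there (here refl))
    with classify C x₁ y₁ (here refl) | classify C x₂ y₂ (there (here refl)) | uniqueᴱ C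
  ... | hasPath P P⊆E | _ | _ = solve-path IH C ≢1 3∣ P P⊆E
  ... | hasTriangle a b c u ⊆V ⊆E cl | _ | _ = solve-triangle IH C 3∣ a b c u ⊆V ⊆E cl
  ... | hasLeaf _ _ _ _ | hasPath P P⊆E | _ = solve-path IH C ≢1 3∣ P P⊆E
  ... | hasLeaf _ _ _ _ | hasTriangle a b c u ⊆V ⊆E cl | _ = solve-triangle IH C 3∣ a b c u ⊆V ⊆E cl
  ... | hasLeaf x y e≡xy only-y | hasLeaf z w f≡zw only-w | (e≢f ∷ _) ∷ _ =
    solve-leaves IH C 3∣ x y z w xy zw only-y only-w
      (λ { refl → e≢f (trans e≡xy (trans (cong (edge x) (sym (only-y zw))) (sym f≡zw))) })
      (λ { refl → e≢f (trans e≡xy (trans (cong (edge x) (sym (only-y (flip-∈ z x zw))))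
                                         (trans (edge-comm x z) (sym f≡zw)))) })
      (λ { refl → e≢f (trans e≡xy (trans (edge-comm x z) (trans (cong (edge z) (only-w (flip-∈ x z xy)))
                                         (sym f≡zw)))) })
    where
    xy = subst (_∈ _) e≡xy (here refl)
    zw = subst (_∈ _) f≡zw (there (here refl))

  -- Strong induction on the number of vertices plus edges, run as structural recursion on a strict
  -- upper bound.
  solve-below : ∀ n → SolvableBelow n
  solve-below (suc n) V E (s≤s m≤n) = go E m≤n
    where
    go : ∀ E → length V + length E ≤ n → Solvable V E
    go []          m≤n = solve-edgeless V λ V′ E′ lt → solve-below n V′ E′ (≤-trans lt m≤n)
    go (e ∷ f ∷ E) m≤n = solve-two-edges V e f E λ V′ E′ lt → solve-below n V′ E′ (≤-trans lt m≤n)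
    go (e ∷ [])    m≤n C with spanned C (here refl)
    ... | spans {x} {y} _ _ _ refl =
      solve-one-edge V x y (λ V′ E′ lt → solve-below n V′ E′ (≤-trans lt m≤n)) C

  join-decomposable : ∀ V E → Solvable V E
  join-decomposable V E = solve-below _ V E ≤-refl

-- The edge list of a complete graph, its size, and new vertices.

completeEdges : List ℕ → List Edge
completeEdges []      = []
completeEdges (x ∷ V) = map (edge x) V ++ completeEdges V

∈-completeEdges⁺ : ∀ {V x y} → x ∈ V → y ∈ V → x ≢ y → edge x y ∈ completeEdges V
∈-completeEdges⁺ (here refl) (here refl)  x≢y = contradiction refl x≢y
∈-completeEdges⁺ {V} {x} {y} (here refl) (there y∈V) x≢y = ∈-++⁺ˡ (∈-map⁺ (edge x) y∈V)
∈-completeEdges⁺ {V} {x} {y} (there x∈V) (here refl) x≢y =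
  ∈-++⁺ˡ (subst (_∈ map (edge y) _) (edge-comm y x) (∈-map⁺ (edge y) x∈V))
∈-completeEdges⁺ {z ∷ V} (there x∈V) (there y∈V) x≢y =
  ∈-++⁺ʳ (map (edge z) V) (∈-completeEdges⁺ x∈V y∈V x≢y)

∈-completeEdges⁻ : ∀ {V e} → Unique V → e ∈ completeEdges V → Spans V e
∈-completeEdges⁻ {x ∷ V} (x∉ ∷ u) e∈ with ∈-++⁻ (map (edge x) V) e∈
... | inj₁ e∈xV with y , y∈V , eq ← ∈-map⁻ (edge x) e∈xV =
  spans (here refl) (there y∈V) (All.lookup x∉ y∈V) eq
... | inj₂ e∈V with spans a∈V b∈V a≢b eq ← ∈-completeEdges⁻ u e∈V =
  spans (there a∈V) (there b∈V) a≢b eq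

completeEdges-unique : ∀ {V} → Unique V → Unique (completeEdges V)
completeEdges-unique {[]}    _        = []
completeEdges-unique {x ∷ V} (x∉ ∷ u) =
  Unique.++⁺ (Unique.map⁺ (edge-injectiveʳ x) (Unique.drop⁺ 1 (x∉ ∷ u))) (completeEdges-unique u) disjoint
  where
  disjoint : Disjoint (map (edge x) V) (completeEdges V)
  disjoint (e∈xV , e∈V) with ∈-map⁻ (edge x) e∈xV | ∈-completeEdges⁻ u e∈V
  ... | y , _ , refl | spans {a} {b} a∈V b∈V _ eq with edge-injective x y a b eq
  ...   | inj₁ (refl , _) = All.lookup x∉ a∈V refl
  ...   | inj₂ (refl , _) = All.lookup x∉ b∈V refl

length-completeEdges : ∀ x V → length (completeEdges (x ∷ V)) ≡ length V + length (completeEdges V)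
length-completeEdges x V = trans (length-++ (map (edge x) V)) (cong (_+ _) (length-map (edge x) V))

-- Three vertices at a time: if `l` others remain, the three account for (l + 2) + (l + 1) + l = 3(l
-- + 1) edges. At the end at most one vertex is left, with no edge.
3∣length-completeEdges : ∀ k r V → length V ≡ k * 3 + r → r ≡ 0 ⊎ r ≡ 1 → 3 ∣ length (completeEdges V)
3∣length-completeEdges zero    r []           eq h = 3 ∣0
3∣length-completeEdges zero    r (_ ∷ [])     eq h = 3 ∣0
3∣length-completeEdges zero    r (_ ∷ _ ∷ _)  eq (inj₁ refl) with () ← eq
3∣length-completeEdges zero    r (_ ∷ _ ∷ _)  eq (inj₂ refl) with () ← eq
3∣length-completeEdges (suc k) r (a ∷ b ∷ c ∷ V) eq h =
  subst (3 ∣_) (sym total) (∣m∣n⇒∣m+n (m∣m*n (suc (length V)))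
    (3∣length-completeEdges k r V (suc-injective (suc-injective (suc-injective eq))) h))
  where
  arith : ∀ l m → suc (suc l) + (suc l + (l + m)) ≡ 3 * suc l + m
  arith = solve-∀

  total : length (completeEdges (a ∷ b ∷ c ∷ V)) ≡ 3 * suc (length V) + length (completeEdges V)
  total rewrite length-completeEdges a (b ∷ c ∷ V) | length-completeEdges b (c ∷ V) | length-completeEdges c V =
    arith (length V) _

-- The successor of the sum exceeds every entry.
fresh : (V : List ℕ) → ∃[ x ] All (x ≢_) V
fresh V = suc (sum V) , All.tabulate λ y∈V eq → <-irrefl (sym eq) (s≤s (∈⇒≤sum y∈V))
  where
  ∈⇒≤sum : ∀ {V y} → y ∈ V → y ≤ sum V
  ∈⇒≤sum (here refl) = m≤m+n _ _
  ∈⇒≤sum (there y∈V) = ≤-trans (∈⇒≤sum y∈V) (m≤n+m _ _)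

extend : ∀ k (V : List ℕ) → Unique V → ∃[ W ] Unique W × V ⊆ₗ W × length W ≡ k + length V
extend zero    V u = V , u , id , refl
extend (suc k) V u 
  with W , uW , V⊆W , eq ← extend k V u
  with x , x∉W ← fresh W =
  x ∷ W , x∉W ∷ uW , there ∘ V⊆W , cong suc eq

-- Puts the complete graph into join form: the edges from `p` and those from `q` interleave to the
-- spokes.
completeEdges-join : ∀ p q V → completeEdges (p ∷ q ∷ V) ↭ Join.join p q V (completeEdges V)
completeEdges-join p q V = ↭-prep (edge p q)
  (↭-trans (↭-reflexive (sym (++-assoc (map (edge p) V) (map (edge q) V) (completeEdges V))))
           (++⁺ʳ (completeEdges V) (go V)))
  where
  go : ∀ V → map (edge p) V ++ map (edge q) V ↭ Join.spokes p q V
  go []      = ↭-refl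
  go (x ∷ V) rewrite edge-comm p x | edge-comm q x = ↭-prep (edge x p)
    (↭-trans (shift (edge x q) (map (edge p) V) (map (edge q) V)) (↭-prep (edge x q) (go V)))

-- Transport of paths along isomorphisms and subgraphs.

open Graph using (support; Adj?)

PathIn : Graph → Path → Set
PathIn G P = Adj G a b × Adj G b c × Adj G c d
  where open Path P

∈-vertices : ∀ G {x y} → Adj G x y → x ∈ vertices G × y ∈ vertices G
∈-vertices G xy = support G xy , support G (Graph.sym G xy)

module _ {G H : Graph} (iso : G ≅ H) where
  open _≅_ iso

  mapPath : ∀ P → PathIn G P → ∃[ Q ] PathIn H Q
  mapPath (mkPath a b c d distinct) (ab , bc , cd) =
    mkPath (to a) (to b) (to c) (to d) (injectiveOn (a ∷ b ∷ c ∷ d ∷ []) distinct ⊆G) ,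
    adj ab , adj bc , adj cd
    where
    adj : ∀ {x y} → Adj G x y → Adj H (to x) (to y)
    adj xy with x∈ , y∈ ← ∈-vertices G xy = Equivalence.to (Adj⇔ x∈ y∈) xy

    ⊆G : a ∷ b ∷ c ∷ d ∷ [] ⊆ₗ vertices G
    ⊆G = All.lookup (support G ab ∷ support G bc ∷ ∈-vertices G cd .proj₁ ∷ ∈-vertices G cd .proj₂ ∷ [])

    injectiveOn : ∀ xs → Unique xs → xs ⊆ₗ vertices G → Unique (map to xs)
    injectiveOn []       _        _  = []
    injectiveOn (x ∷ xs) (x∉ ∷ u) ⊆G =
      All.map⁺ (All.tabulate λ y∈xs eq → All.lookup x∉ y∈xs
        (injective (⊆G (here refl)) (⊆G (there y∈xs)) eq)) ∷
      injectiveOn xs u (⊆G ∘ there)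

  ≅-sym : H ≅ G
  ≅-sym = record
    { to         = from
    ; to-∈       = λ z∈H → from-∈ z∈H
    ; injective  = λ {x} {y} x∈H y∈H eq → trans (sym (to-from x∈H)) (trans (cong to eq) (to-from y∈H))
    ; surjective = λ {x} x∈G → to x , to-∈ x∈G ,
                     injective (from-∈ (to-∈ x∈G)) x∈G (to-from (to-∈ x∈G))
    ; Adj⇔       = λ {x} {y} x∈H y∈H → mk⇔
        (λ xy → Equivalence.from (Adj⇔ (from-∈ x∈H) (from-∈ y∈H))
                  (subst₂ (Adj H) (sym (to-from x∈H)) (sym (to-from y∈H)) xy))
        (λ xy → subst₂ (Adj H) (to-from x∈H) (to-from y∈H)
                  (Equivalence.to (Adj⇔ (from-∈ x∈H) (from-∈ y∈H)) xy))
    }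
    where
    from : ℕ → ℕ
    from z with z ∈? vertices H
    ... | yes z∈H = proj₁ (surjective z∈H)
    -- An arbitrary default: an isomorphism is constrained only on vertices.
    ... | no  _   = 0

    from-∈ : ∀ {z} → z ∈ vertices H → from z ∈ vertices G
    from-∈ {z} z∈H with z ∈? vertices H
    ... | yes z∈H′ = proj₁ (proj₂ (surjective z∈H′))
    ... | no  z∉H  = contradiction z∈H z∉H

    to-from : ∀ {z} → z ∈ vertices H → to (from z) ≡ z
    to-from {z} z∈H with z ∈? vertices H
    ... | yes z∈H′ = proj₂ (proj₂ (surjective z∈H′))
    ... | no  z∉H  = contradiction z∈H z∉H

PathIn-⊑ : ∀ {G H} → G ⊑ H → ∀ P → PathIn G P → PathIn H P
PathIn-⊑ G⊑H _ (ab , bc , cd) = Adj⊆ ab , Adj⊆ bc , Adj⊆ cd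
  where open _⊑_ G⊑H

≤ᴳ-path : ∀ {G H} → G ≤ᴳ H → ∀ P → PathIn G P → ∃[ Q ] PathIn H Q
≤ᴳ-path (G′ , G′⊑H , G≅G′) P P∈G with Q , Q∈G′ ← mapPath G≅G′ P P∈G = Q , PathIn-⊑ G′⊑H Q Q∈G′

-- A path as a graph isomorphic to P₄.

module _ (P : Path) where
  open Path P using (a; b; c; d; distinct)

  private
    vs : List ℕ
    vs = a ∷ b ∷ c ∷ d ∷ []

    at : ℕ → ℕ
    at 0 = a
    at 1 = b
    at 2 = c
    -- Both the value at 3 and the default beyond the path.
    at _ = d

    -- Through this, injectivity and surjectivity of `at` are inherited from `lookup` in a
    -- duplicate-free list.
    at-toℕ : ∀ (i : Fin 4) → at (toℕ i) ≡ lookup vs i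
    at-toℕ 0F = refl
    at-toℕ 1F = refl
    at-toℕ 2F = refl
    at-toℕ 3F = refl

    at-∈ : ∀ {x} → x ∈ upTo 4 → at x ∈ vs
    at-∈ x∈ = subst (_∈ vs) (trans (sym (at-toℕ i)) (cong at (Fin.toℕ-fromℕ< (∈-upTo⁻ x∈)))) (∈-lookup i)
      where i = fromℕ< (∈-upTo⁻ x∈)

    at-injective : ∀ {x y} → x < 4 → y < 4 → at x ≡ at y → x ≡ y
    at-injective {x} {y} x<4 y<4 eq = begin
      x                 ≡⟨ Fin.toℕ-fromℕ< x<4 ⟨
      toℕ (fromℕ< x<4)  ≡⟨ cong toℕ (unique⇒lookup-injective distinct _ _ lookup-eq) ⟩
      toℕ (fromℕ< y<4)  ≡⟨ Fin.toℕ-fromℕ< y<4 ⟩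
      y                 ∎
      where
      open ≡-Reasoning
      lookup-eq : lookup vs (fromℕ< x<4) ≡ lookup vs (fromℕ< y<4)
      lookup-eq = begin
        lookup vs (fromℕ< x<4)  ≡⟨ at-toℕ (fromℕ< x<4) ⟨
        at (toℕ (fromℕ< x<4))   ≡⟨ cong at (Fin.toℕ-fromℕ< x<4) ⟩
        at x                    ≡⟨ eq ⟩
        at y                    ≡⟨ cong at (Fin.toℕ-fromℕ< y<4) ⟨
        at (toℕ (fromℕ< y<4))   ≡⟨ at-toℕ (fromℕ< y<4) ⟩
        lookup vs (fromℕ< y<4)  ∎

    at-surjective : ∀ {z} → z ∈ vs → ∃[ x ] x ∈ upTo 4 × at x ≡ z
    at-surjective z∈ = toℕ (index z∈) , ∈-upTo⁺ (Fin.toℕ<n (index z∈)) ,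
                       trans (at-toℕ (index z∈)) (sym (lookup-index z∈))

    step⁺ : ∀ x → suc x < 4 → edge (at x) (at (suc x)) ∈ edges P
    step⁺ 0 _ = here refl
    step⁺ 1 _ = there (here refl)
    step⁺ 2 _ = there (there (here refl))
    step⁺ (suc (suc (suc _))) (s≤s (s≤s (s≤s (s≤s ()))))

    step⁻ : ∀ {e} → e ∈ edges P → ∃[ x ] suc x < 4 × e ≡ edge (at x) (at (suc x))
    step⁻ (here eq)                 = 0 , s≤s (s≤s z≤n) , eq
    step⁻ (there (here eq))         = 1 , s≤s (s≤s (s≤s z≤n)) , eq
    step⁻ (there (there (here eq))) = 2 , s≤s (s≤s (s≤s (s≤s z≤n))) , eq

    endpoints-∈ : ∀ {x y} → edge x y ∈ edges P → x ∈ vs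
    endpoints-∈ {x} {y} xy with i , i<3 , eq ← step⁻ xy with edge-injective x y (at i) (at (suc i)) eq
    ... | inj₁ (refl , _) = at-∈ (∈-upTo⁺ (<-trans (n<1+n i) i<3))
    ... | inj₂ (refl , _) = at-∈ (∈-upTo⁺ i<3)

    loopless : ∀ {x y} → x ≡ y → ¬ edge x y ∈ edges P
    loopless {x} refl xx with i , i<3 , eq ← step⁻ xx =
      1+n≢n (sym (at-injective (<-trans (n<1+n i) i<3) i<3
        ([ (λ (p , q) → trans (sym p) q) , (λ (p , q) → trans (sym q) p) ]′ (edge-injective x x _ _ eq))))

  pathGraph : Graph
  pathGraph = record
    { vertices = vs
    ; unique   = distinct
    ; Adj      = λ x y → edge x y ∈ edges P
    ; Adj?     = λ x y → edge x y ∈ᴱ? edges P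
    ; sym      = λ {x} {y} → subst (_∈ edges P) (edge-comm x y)
    ; irrefl   = loopless
    ; support  = endpoints-∈
    }

  P₄≅pathGraph : P₄ ≅ pathGraph
  P₄≅pathGraph = record
    { to         = at
    ; to-∈       = at-∈
    ; injective  = λ x∈ y∈ → at-injective (∈-upTo⁻ x∈) (∈-upTo⁻ y∈)
    ; surjective = at-surjective
    ; Adj⇔       = λ x∈ y∈ → mk⇔ to (from (∈-upTo⁻ x∈) (∈-upTo⁻ y∈))
    }
    where
    to : ∀ {x y} → Adj P₄ x y → edge (at x) (at y) ∈ edges P
    to         (_   , y<4 , inj₁ refl) = step⁺ _ y<4
    to {x} {y} (x<4 , _   , inj₂ refl) = subst (_∈ edges P) (edge-comm (at y) (at x)) (step⁺ _ x<4)

    from : ∀ {x y} → x < 4 → y < 4 → edge (at x) (at y) ∈ edges P → Adj P₄ x y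
    from {x} {y} x<4 y<4 xy with i , i<3 , eq ← step⁻ xy
      with i<4 ← <-trans (n<1+n i) i<3
      with edge-injective (at x) (at y) (at i) (at (suc i)) eq
    ... | inj₁ (x≡ , y≡) = x<4 , y<4 ,
      inj₁ (trans (cong suc (at-injective x<4 i<4 x≡)) (sym (at-injective y<4 i<3 y≡)))
    ... | inj₂ (x≡ , y≡) = x<4 , y<4 ,
      inj₂ (trans (cong suc (at-injective y<4 i<4 y≡)) (sym (at-injective x<4 i<3 x≡)))

  pathGraph-⊑ : ∀ {G} → PathIn G P → pathGraph ⊑ G
  pathGraph-⊑ {G} (ab , bc , cd) = record
    { vertices⊆ = All.lookup (support G ab ∷ support G bc ∷ ∈-vertices G cd .proj₁ ∷ ∈-vertices G cd .proj₂ ∷ [])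
    ; Adj⊆      = λ where
        (here eq)                 → orient ab eq
        (there (here eq))         → orient bc eq
        (there (there (here eq))) → orient cd eq
    }
    where
    orient : ∀ {x y u w} → Adj G u w → edge x y ≡ edge u w → Adj G x y
    orient {x} {y} {u} {w} uw eq with edge-injective x y u w eq
    ... | inj₁ (refl , refl) = uw
    ... | inj₂ (refl , refl) = Graph.sym G uw

-- From a decomposition of the edge list to a P₄-design.

complete-Adj : ∀ {V x y} (u : Unique V) → edge x y ∈ completeEdges V → Adj (complete V u) x y
complete-Adj {x = x} {y} u xy with spans {a} {b} a∈V b∈V a≢b eq ← ∈-completeEdges⁻ u xy
  with edge-injective x y a b eq
... | inj₁ (refl , refl) = a∈V , b∈V , a≢b
... | inj₂ (refl , refl) = b∈V , a∈V , a≢b ∘ sym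

-- The pieces of a duplicate-free concatenation are disjoint. This yields the uniqueness of the
-- block through an edge.
concatMap-index-unique : ∀ {A B : Set} (f : A → List B) xs {z} → Unique (concatMap f xs) →
                         ∀ i j → z ∈ f (lookup xs i) → z ∈ f (lookup xs j) → i ≡ j
concatMap-index-unique f (x ∷ xs) u zero    zero    _  _  = refl
concatMap-index-unique f (x ∷ xs) u zero    (suc j) z∈ w∈ =
  ⊥-elim (proj₂ (unique-++⁻ (f x) u) z∈ (∈-concatMap⁺ f {xs = xs} (lose (∈-lookup j) w∈)))
concatMap-index-unique f (x ∷ xs) u (suc i) zero    z∈ w∈ =
  ⊥-elim (proj₂ (unique-++⁻ (f x) u) w∈ (∈-concatMap⁺ f {xs = xs} (lose (∈-lookup i) z∈)))
concatMap-index-unique f (x ∷ xs) u (suc i) (suc j) z∈ w∈ =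
  cong suc (concatMap-index-unique f xs (proj₁ (unique-++⁻ (f x) u)) i j z∈ w∈)

-- `Q` witnesses that P₄ is a subgraph of the complete graph; the permutation `σ` places each edge
-- in exactly one path.
pathDesign : ∀ {W} (uW : Unique W) Q → PathIn (complete W uW) Q → ∀ ps →
             completeEdges W ↭ concatMap edges ps → Design (complete W uW) P₄
pathDesign {W} uW Q Q∈K ps σ = record
  { Γ≤K       = pathGraph Q , pathGraph-⊑ Q Q∈K , P₄≅pathGraph Q
  ; size      = length ps
  ; block     = pathGraph ∘ lookup ps
  ; block⊑K   = λ i → pathGraph-⊑ (lookup ps i)
                  (adj i (here refl) , adj i (there (here refl)) , adj i (there (there (here refl))))
  ; block≅Γ   = λ i → ≅-sym (P₄≅pathGraph (lookup ps i))
  ; nonempty  = λ i → _ , _ , here refl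
  ; partition = λ (x∈W , y∈W , x≢y) →
      let xy = ∈-concatMap⁻ edges {xs = ps} (∈-resp-↭ σ (∈-completeEdges⁺ x∈W y∈W x≢y))
      in index xy , lookup-index xy ,
         concatMap-index-unique edges ps (unique-resp-↭ σ (completeEdges-unique uW)) _ _ (lookup-index xy)
  }
  where
  adj : ∀ i {x y} → edge x y ∈ edges (lookup ps i) → Adj (complete W uW) x y
  adj i xy = complete-Adj uW (∈-resp-↭ (↭-sym σ) (∈-concatMap⁺ edges {xs = ps} (lose (∈-lookup i) xy)))

-- The down-link: chosen paths, uncovered edges, and the new design.

module _ {Γ : Graph} {v : ℕ} (P₄≤Γ : P₄ ≤ᴳ Γ) (ℬ : DesignOfOrder Γ v) where
  open DesignOfOrder ℬ renaming (unique to points-unique)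

  private
    K : Graph
    K = complete points points-unique

    pathΓ : ∃[ Q ] PathIn Γ Q
    pathΓ = ≤ᴳ-path P₄≤Γ (mkPath 0 1 2 3 (from-yes (unique? _≟_ (0 ∷ 1 ∷ 2 ∷ 3 ∷ []))))
      (step 0 (s≤s z≤n) , step 1 (s≤s (s≤s z≤n)) , step 2 (s≤s (s≤s (s≤s z≤n))))
      where
      step : ∀ x → x < 3 → Adj P₄ x (suc x)
      step x x<3 = <-trans x<3 (n<1+n 3) , s≤s x<3 , inj₁ refl

    -- Serves twice: it yields a P₄ inside the new complete graph, and two distinct points, so that
    -- `V` has more than one vertex.
    pathK : ∃[ Q ] PathIn K Q
    pathK = ≤ᴳ-path Γ≤K (proj₁ pathΓ) (proj₂ pathΓ)

    pathBlock : ∀ i → ∃[ Q ] PathIn (block i) Q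
    pathBlock i = mapPath (≅-sym (block≅Γ i)) (proj₁ pathΓ) (proj₂ pathΓ)

    chosen : Fin size → Path
    chosen = proj₁ ∘ pathBlock

    chosen⊑ : ∀ i → pathGraph (chosen i) ⊑ block i
    chosen⊑ i = pathGraph-⊑ (chosen i) (proj₂ (pathBlock i))

    used : List Edge
    used = concatMap edges (tabulate chosen)

    span : ∀ {e} P → e ∈ edges P → ∃₂ λ x y → e ≡ edge x y
    span P (here eq)                 = _ , _ , eq
    span P (there (here eq))         = _ , _ , eq
    span P (there (there (here eq))) = _ , _ , eq

    adjK : ∀ i {x y} → edge x y ∈ edges (chosen i) → Adj K x y
    adjK i xy = _⊑_.Adj⊆ (block⊑K i) (_⊑_.Adj⊆ (chosen⊑ i) xy)

    -- An edge of a chosen path is an edge of its block, and the blocks partition the edges of `K`.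
    -- Hence the chosen paths are edge-disjoint.
    same-block : ∀ i j {e} → e ∈ edges (chosen i) → e ∈ edges (chosen j) → i ≡ j
    same-block i j ei ej with x , y , refl ← span (chosen i) ei
      with _ , _ , unique ← partition (adjK i ei) =
      trans (sym (unique (_⊑_.Adj⊆ (chosen⊑ i) ei))) (unique (_⊑_.Adj⊆ (chosen⊑ j) ej))

    used-unique : Unique used
    used-unique = subst (Unique ∘ concat) (sym (map-tabulate chosen edges)) (Unique.concat⁺
      (All.tabulate⁺ (λ i → edges-unique (chosen i)))
      (AllPairs.tabulate⁺ λ i≢j (ei , ej) → i≢j (same-block _ _ ei ej)))

    used⊆ : ∀ {V} → points ⊆ₗ V → used ⊆ₗ completeEdges V
    used⊆ points⊆V e∈ with P , P∈ , e∈P ← find (∈-concatMap⁻ edges {xs = tabulate chosen} e∈)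
      with i , refl ← ∈-tabulate⁻ P∈
      with x , y , refl ← span (chosen i) e∈P
      with x∈ , y∈ , x≢y ← adjK i e∈P = ∈-completeEdges⁺ (points⊆V x∈) (points⊆V y∈) x≢y

  -- The chosen paths live inside `V`. Removing them from the complete graph on `p`, `q`, `V` leaves
  -- the join of `p`, `q` with the uncovered graph `E` on `V`, which is decomposable. The chosen
  -- paths become blocks of the new design, and each old block is sent to its own.
  linkAfterExtension : ∀ p q V → Unique (p ∷ q ∷ V) → points ⊆ₗ V →
                       3 ∣ length (completeEdges (p ∷ q ∷ V)) →
                       DownLinkedToOrder ℬ (length (p ∷ q ∷ V))
  linkAfterExtension p q V uW@(_ ∷ _ ∷ uV) points⊆V 3∣
    with E , σ ← complement used-unique (used⊆ points⊆V) = ℬ′ , record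
      { f        = λ i → index (chosen∈paths i)
      ; subgraph = λ i → subst (λ P → pathGraph P ⊑ block i) (lookup-index (chosen∈paths i)) (chosen⊑ i)
      }
    where
    open Join p q

    splitting : completeEdges (p ∷ q ∷ V) ↭ used ++ join V E
    splitting = ↭-trans (completeEdges-join p q V)
                        (↭-trans (join-↭ (↭-refl {x = V}) σ) (join-++ [] V used E))

    config : Config V E
    config = record
      { uniqueⱽ = uW
      ; uniqueᴱ = proj₁ (unique-++⁻ used (unique-resp-↭ σ (completeEdges-unique uV)))
      ; spanned = λ e∈E → ∈-completeEdges⁻ uV (∈-resp-↭ (↭-sym σ) (∈-++⁺ʳ used e∈E))
      }

    several : length V ≢ 1
    several ≡1 with _ , (a∈ , b∈ , a≢b) , _ ← pathK = go V ≡1 (points⊆V a∈) (points⊆V b∈) a≢b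
      where
      go : ∀ V {a b} → length V ≡ 1 → a ∈ V → b ∈ V → a ≢ b → ⊥
      go (_ ∷ []) _ (here refl) (here refl) a≢b = a≢b refl

    rest : Decomposable (join V E)
    rest = join-decomposable V E config several
      -- The whole complete graph and the chosen paths both have size divisible by 3, hence so has
      -- the join.
      (∣m+n∣m⇒∣n (subst (3 ∣_) (trans (↭-length splitting) (length-++ used)) 3∣)
                 (3∣length-paths (tabulate chosen)))

    paths : List Path
    paths = tabulate chosen ++ proj₁ rest

    chosen∈paths : ∀ i → chosen i ∈ paths
    chosen∈paths i = ∈-++⁺ˡ (∈-tabulate⁺ i)

    pathW : ∃[ Q ] PathIn (complete (p ∷ q ∷ V) uW) Q
    pathW with Q , ab , bc , cd ← pathK = Q , lift ab , lift bc , lift cd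
      where
      lift : ∀ {x y} → Adj K x y → Adj (complete (p ∷ q ∷ V) uW) x y
      lift (x∈ , y∈ , x≢y) = there (there (points⊆V x∈)) , there (there (points⊆V y∈)) , x≢y

    ℬ′ : DesignOfOrder P₄ (length (p ∷ q ∷ V))
    ℬ′ = record
      { points  = p ∷ q ∷ V
      ; unique  = uW
      ; order≡v = refl
      ; design  = pathDesign uW (proj₁ pathW) (proj₂ pathW) paths
          (↭-trans splitting (↭-trans (++⁺ˡ used (proj₂ rest))
            (↭-reflexive (sym (concatMap-++ edges (tabulate chosen) (proj₁ rest))))))
      }

  linkTo : ∀ {n} → n ≥ v + 2 → n % 3 ≡ 0 ⊎ n % 3 ≡ 1 → DownLinkedToOrder ℬ n
  linkTo {n} n≥v+2 n%3
    -- Two of the new points are reserved as `q` and `p`, which is possible as n ≥ v + 2; the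
    -- remaining `n ∸ (v + 2)` are added to the old points.
    with V , uV , points⊆V , |V| ← extend (n ∸ (v + 2)) points points-unique
    with q , q∉V ← fresh V
    with p , p∉W ← fresh (q ∷ V)
    = subst (DownLinkedToOrder ℬ) |W| (linkAfterExtension p q V (p∉W ∷ q∉V ∷ uV) points⊆V
        (3∣length-completeEdges (n / 3) (n % 3) (p ∷ q ∷ V)
          (trans |W| (trans (m≡m%n+[m/n]*n n 3) (+-comm (n % 3) _))) n%3))
    where
    |W| : 2 + length V ≡ n
    |W| = begin
      2 + length V                           ≡⟨ cong (2 +_) |V| ⟩
      2 + (n ∸ (v + 2) + length points)      ≡⟨ cong (λ m → 2 + (n ∸ (v + 2) + m)) order≡v ⟩
      2 + (n ∸ (v + 2) + v)                  ≡⟨ +-comm 2 _ ⟩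
      n ∸ (v + 2) + v + 2                    ≡⟨ +-assoc (n ∸ (v + 2)) v 2 ⟩
      n ∸ (v + 2) + (v + 2)                  ≡⟨ m∸n+n≡m n≥v+2 ⟩
      n                                      ∎
      where open ≡-Reasoning

corollary3p2 : (Γ : Graph) (v : ℕ) → P₄ ≤ᴳ Γ → DesignOfOrder Γ v →
    ((λ n → n ≥ v + 2 × (n % 3 ≡ 0 ⊎ n % 3 ≡ 1)) ⊆ ℒ₂ Γ v) × (ℒ₂ Γ v ⊆ ℒ₁ Γ v)
corollary3p2 Γ v P₄≤Γ ℬ =
  -- For the second inclusion the given design `ℬ` supplies an instance of the universal statement.
  (λ (n≥v+2 , n%3) ℬ′ → linkTo P₄≤Γ ℬ′ n≥v+2 n%3) , (λ linked → ℬ , linked ℬ)
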